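{- Let $G$ be a finite simple connected graph with $|E(G)|>\nu_2(G)$ and $\nu_2(G)\ge 5$. If $\gamma(G)=\nu_2(G)-1$, then $G$ is isomorphic to $T^{\nu_2(G)}_{s,t}$ for some positive integers $s,t$ with $s+4=\nu_2(G)$.
   Context: A 2-packing of a graph $G$ is a set $R\subseteq E(G)$ such that no three edges of $R$ are incident with a common vertex; $\nu_2(G)$ is the maximum size of a 2-packing. $\gamma(G)$ is the domination number: the minimum size of a set $D\subseteq V(G)$ such that every vertex is in $D$ or adjacent to a vertex of $D$. For positive integers $s,t$ and $r=s+4$, $T^{r}_{s,t}$ is the tree with vertex set $\{v_0,\ldots,v_4\}\cup\{p_1,\ldots,p_s\}\cup\{q_1,\ldots,q_s\}\cup\{w_1,\ldots,w_t\}$ (all distinct) and edge set $\{v_0v_1,v_1v_2,v_2v_3,v_3v_4\}\cup\{p_iq_i:1\le i\le s\}\cup\{v_2w_i:1\le i\le t\}\cup\{v_2p_i:1\le i\le s\}$. -}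

module Defs where

open import Data.Nat using (ℕ; zero; suc; _+_; _≤_; _<_; _≡ᵇ_; _<ᵇ_)
open import Data.Bool using (Bool; true; false; if_then_else_; _∧_; _∨_)
open import Data.Fin using (Fin; toℕ) renaming (zero to fz; suc to fs)
open import Data.Fin.Properties using () renaming (_≟_ to _≟F_)
open import Data.Product using (Σ; ∃; _×_; _,_)
open import Data.Sum using (_⊎_)
open import Relation.Nullary.Decidable using (⌊_⌋)
open import Relation.Binary.PropositionalEquality using (_≡_)
open import Function.Bundles using (Inverse; _↔_)

sumF : {n : ℕ} → (Fin n → ℕ) → ℕ
sumF {zero} f = 0
sumF {suc n} f = f fz + sumF (λ i → f (fs i))

countF : {n : ℕ} → (Fin n → Bool) → ℕ
countF p = sumF (λ i → if p i then 1 else 0)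

record Graph : Set where
  field
    n       : ℕ
    adj     : Fin n → Fin n → Bool
    adj-sym : ∀ u v → adj u v ≡ adj v u
    adj-irr : ∀ u → adj u u ≡ false
open Graph public

pairCount : {n : ℕ} → (Fin n → Fin n → Bool) → ℕ
pairCount R = sumF (λ u → countF (λ v → (toℕ u <ᵇ toℕ v) ∧ R u v))

edgeCount : Graph → ℕ
edgeCount G = pairCount (adj G)

record EdgeSubset (G : Graph) : Set where
  field
    R     : Fin (n G) → Fin (n G) → Bool
    R-sym : ∀ u v → R u v ≡ R v u
    R-sub : ∀ u v → R u v ≡ true → adj G u v ≡ true
open EdgeSubset public

esize : {G : Graph} → EdgeSubset G → ℕ
esize S = pairCount (R S)

edeg : {G : Graph} → EdgeSubset G → Fin (n G) → ℕ
edeg S v = countF (R S v)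

Is2Packing : (G : Graph) → EdgeSubset G → Set
Is2Packing G S = ∀ v → edeg S v ≤ 2

IsNu2 : Graph → ℕ → Set
IsNu2 G k = (Σ (EdgeSubset G) λ S → Is2Packing G S × esize S ≡ k)
          × (∀ (S : EdgeSubset G) → Is2Packing G S → esize S ≤ k)

IsDominating : (G : Graph) → (Fin (n G) → Bool) → Set
IsDominating G D = ∀ v → D v ≡ true ⊎ (∃ λ u → adj G v u ≡ true × D u ≡ true)

IsGamma : Graph → ℕ → Set
IsGamma G k = (Σ (Fin (n G) → Bool) λ D → IsDominating G D × countF D ≡ k)
            × (∀ D → IsDominating G D → k ≤ countF D)

data Walk (G : Graph) : Fin (n G) → Fin (n G) → Set where
  here : ∀ {u} → Walk G u u
  step : ∀ {u w v} → adj G u w ≡ true → Walk G w v → Walk G u v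

Connected : Graph → Set
Connected G = ∀ u v → Walk G u v

-- The tree T^{s+4}_{s,t}: vertices v₀..v₄, p₁..pₛ, q₁..qₛ, w₁..wₜ
data TV (s t : ℕ) : Set where
  vv : Fin 5 → TV s t
  pv : Fin s → TV s t
  qv : Fin s → TV s t
  wv : Fin t → TV s t

is2 : Fin 5 → Bool
is2 i = toℕ i ≡ᵇ 2

Tadj : (s t : ℕ) → TV s t → TV s t → Bool
Tadj s t (vv i) (vv j) = (suc (toℕ i) ≡ᵇ toℕ j) ∨ (suc (toℕ j) ≡ᵇ toℕ i)
Tadj s t (vv i) (pv _) = is2 i
Tadj s t (pv _) (vv i) = is2 i
Tadj s t (vv i) (wv _) = is2 i
Tadj s t (wv _) (vv i) = is2 i
Tadj s t (pv i) (qv j) = ⌊ i ≟F j ⌋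
Tadj s t (qv i) (pv j) = ⌊ i ≟F j ⌋
Tadj s t _ _ = false

IsoT : Graph → ℕ → ℕ → Set
IsoT G s t = Σ (Fin (n G) ↔ TV s t) λ f →
  ∀ u v → adj G u v ≡ Tadj s t (Inverse.to f u) (Inverse.to f v)

{-# OPTIONS --safe #-}
module Submission where

-- Put m = γ = ν₂ − 1.  A connected graph with at least two vertices has a matching M with m edges: as
-- long as M is smaller than γ, a choice of one endpoint per edge of M leaves a vertex undominated, and
-- this vertex starts an augmenting path.  Two edges outside M must share a vertex covered by M,
-- as otherwise M together with both would be a 2-packing of size m + 2.  Since m ≥ 4 and every edge of
-- M is left by some edge outside M, the edges outside M form a star whose centre c is covered by M.
-- If both ends of some other edge of M were adjacent to c, then c and one end of each remaining edge
-- would dominate G with m − 1 vertices.  Hence G is a spider: m − 1 legs of length two, and legs of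
-- length one ending at the partner of c and at the vertices not covered by M.

open import Defs
open import Data.Nat using (ℕ; zero; suc; _+_; _∸_; _≤_; _<_; z≤n; s≤s; s≤s⁻¹; _<ᵇ_)
open import Data.Nat.Properties
  using (≤-refl; ≤-trans; ≤-reflexive; +-mono-≤; +-comm; m≤m+n; m≤n⇒m≤o+n;
         <⇒≤; <⇒≱; <⇒<ᵇ; <-cmp; 1+n≰n)
open import Data.Nat.Solver using (module +-*-Solver)
open import Data.Bool using (Bool; true; false; not; if_then_else_; _∧_; _∨_; _xor_)
open import Data.Bool.Properties using (not-involutive; ¬-not; not-distribʳ-xor; xor-identityʳ)
  renaming (_≟_ to _≟B_)
open import Data.Fin using (Fin; zero; suc; toℕ; punchIn; punchOut) renaming (_<_ to _<F_)
open import Data.Vec using ([]; _∷_; lookup)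
open import Data.Fin.Properties
  using (_≟_; any?; all?; ¬∀⟶∃¬; pigeonhole; toℕ-injective; punchIn-injective; punchInᵢ≢i;
         punchIn-punchOut; suc-injective)
  renaming (<⇒≢ to F<⇒≢)
open import Data.Product using (Σ; ∃; ∃₂; _×_; _,_; proj₁; proj₂)
open import Data.Sum using (_⊎_; inj₁; inj₂)
open import Data.Empty using (⊥; ⊥-elim)
open import Function using (_∘_; case_of_; mk↔ₛ′; mk⇔)
open import Relation.Nullary using (¬_; Dec; yes; no; does; contradiction)
open import Relation.Nullary.Decidable
  using (map′; ¬?; _×-dec_; _⊎-dec_; ⌊_⌋; decidable-stable; dec-true; dec-false; does-⇔; isYes≗does)
open import Relation.Binary.Definitions using (tri<; tri≈; tri>)
open import Relation.Binary.PropositionalEquality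
  using (_≡_; _≢_; refl; sym; trans; cong; cong₂; subst; subst₂; module ≡-Reasoning)

-- Finite sums and counts.

indicator : Bool → ℕ
indicator b = if b then 1 else 0

sumF-mono : ∀ {n} {f g : Fin n → ℕ} → (∀ i → f i ≤ g i) → sumF f ≤ sumF g
sumF-mono {zero}  f≤g = z≤n
sumF-mono {suc n} f≤g = +-mono-≤ (f≤g zero) (sumF-mono (f≤g ∘ suc))

sumF-+ : ∀ {n} (f g : Fin n → ℕ) → sumF (λ i → f i + g i) ≡ sumF f + sumF g
sumF-+ {zero}  f g = refl
sumF-+ {suc n} f g = trans (cong ((f zero + g zero) +_) (sumF-+ (f ∘ suc) (g ∘ suc)))
  (solve 4 (λ a b c d → (a :+ b) :+ (c :+ d) := (a :+ c) :+ (b :+ d)) refl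
    (f zero) (g zero) (sumF (f ∘ suc)) (sumF (g ∘ suc)))
  where open +-*-Solver

sumF-zero : ∀ {n} {f : Fin n → ℕ} → (∀ i → f i ≡ 0) → sumF f ≡ 0
sumF-zero {zero}  f≡0 = refl
sumF-zero {suc n} f≡0 = cong₂ _+_ (f≡0 zero) (sumF-zero (f≡0 ∘ suc))

term≤sumF : ∀ {n} (f : Fin n → ℕ) i → f i ≤ sumF f
term≤sumF f zero    = m≤m+n (f zero) _
term≤sumF f (suc i) = m≤n⇒m≤o+n (f zero) (term≤sumF (f ∘ suc) i)

countF-∨ : ∀ {n} (p q : Fin n → Bool) → countF (λ i → p i ∨ q i) ≤ countF p + countF q
countF-∨ {n} p q =
  ≤-trans (sumF-mono λ i → indicator-∨ (p i) (q i)) (≤-reflexive (sumF-+ {n} _ _))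
  where
  indicator-∨ : ∀ a b → indicator (a ∨ b) ≤ indicator a + indicator b
  indicator-∨ false b = ≤-refl
  indicator-∨ true  b = m≤m+n 1 _

countF-≟ : ∀ {n} (x : Fin n) → countF (λ i → does (x ≟ i)) ≤ 1
countF-≟ {suc n} zero    = s≤s (≤-reflexive (sumF-zero {n} λ _ → refl))
countF-≟ {suc n} (suc x) = countF-≟ x

countF-∧-≟ : ∀ {n} b (x : Fin n) → countF (λ i → b ∧ does (x ≟ i)) ≤ indicator b
countF-∧-≟ {n} false x = ≤-reflexive (sumF-zero {n} λ _ → refl)
countF-∧-≟     true  x = countF-≟ x

image : ∀ {j n} → (Fin j → Fin n) → Fin n → Bool
image f v = does (any? λ i → f i ≟ v)

countF-image : ∀ {j n} (f : Fin j → Fin n) → countF (image f) ≤ j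
countF-image {zero}  {n} f = ≤-reflexive (sumF-zero {n} λ _ → refl)
countF-image {suc j} f =
  ≤-trans (countF-∨ (λ v → does (f zero ≟ v)) (image (f ∘ suc)))
          (+-mono-≤ (countF-≟ (f zero)) (countF-image (f ∘ suc)))

pairCount-disjoint-∨ : ∀ {n} {p q : Fin n → Fin n → Bool} →
  (∀ u v → p u v ≡ true → q u v ≡ true → ⊥) →
  pairCount p + pairCount q ≤ pairCount (λ u v → p u v ∨ q u v)
pairCount-disjoint-∨ {n} {p} {q} disj =
  ≤-trans (≤-reflexive (sym (sumF-+ {n} _ _))) (sumF-mono λ u →
  ≤-trans (≤-reflexive (sym (sumF-+ {n} _ _))) (sumF-mono λ v →
  indicator-disjoint (toℕ u <ᵇ toℕ v) (p u v) (q u v) (disj u v)))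
  where
  indicator-disjoint : ∀ t a b → (a ≡ true → b ≡ true → ⊥) →
    indicator (t ∧ a) + indicator (t ∧ b) ≤ indicator (t ∧ (a ∨ b))
  indicator-disjoint false a     b     d = z≤n
  indicator-disjoint true  false b     d = ≤-refl
  indicator-disjoint true  true  false d = ≤-refl
  indicator-disjoint true  true  true  d = ⊥-elim (d refl refl)

ordered-pair : ∀ {n} (p : Fin n → Fin n → Bool) {x y} →
  toℕ x < toℕ y → p x y ≡ true → 1 ≤ pairCount p
ordered-pair p {x} {y} x<y pxy =
  ≤-trans (≤-trans (≤-reflexive (sym one)) (term≤sumF _ y)) (term≤sumF _ x)
  where
  one : indicator ((toℕ x <ᵇ toℕ y) ∧ p x y) ≡ 1
  one with toℕ x <ᵇ toℕ y | <⇒<ᵇ x<y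
  ... | true | _ rewrite pxy = refl

-- `pairCount` sees a pair in increasing order only, so both orientations are supplied and the right
-- one is used.
1≤pairCount : ∀ {n} (p : Fin n → Fin n → Bool) {u v} → u ≢ v →
  p u v ≡ true → p v u ≡ true → 1 ≤ pairCount p
1≤pairCount p {u} {v} u≢v puv pvu with <-cmp (toℕ u) (toℕ v)
... | tri≈ _ u≡v _ = contradiction (toℕ-injective u≡v) u≢v
... | tri< u<v _ _ = ordered-pair p u<v puv
... | tri> _ _ v<u = ordered-pair p v<u pvu

-- Decidable search, enumeration and choice.

∃Bool? : ∀ {P : Bool → Set} → (∀ b → Dec (P b)) → Dec (∃ P)
∃Bool? P? = map′ (λ { (inj₁ p) → false , p ; (inj₂ p) → true , p })
                 (λ { (false , p) → inj₁ p ; (true , p) → inj₂ p })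
                 (P? false ⊎-dec P? true)

-- Serves to list the leaves of the spider; the length of the list becomes the parameter `t` of the
-- tree.
enumerate : ∀ {n} {P : Fin n → Set} → (∀ i → Dec (P i)) →
  Σ ℕ λ t → Σ (Fin t → Fin n) λ e →
    (∀ {i j} → e i ≡ e j → i ≡ j) × (∀ i → P (e i)) × (∀ {x} → P x → ∃ λ i → e i ≡ x)
enumerate {zero}  P? = 0 , (λ ()) , (λ { {()} }) , (λ ()) , λ { {()} }
enumerate {suc n} {P} P? with enumerate (P? ∘ suc) | P? zero
... | t , e , inj , sound , complete | no ¬p =
  t , suc ∘ e , inj ∘ suc-injective , sound ,
  λ { {zero} p → contradiction p ¬p
    ; {suc x} p → proj₁ (complete p) , cong suc (proj₂ (complete p)) }
... | t , e , inj , sound , complete | yes p₀ =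
  suc t , e′ , inj′ , sound′ , complete′
  where
  e′ : Fin (suc t) → Fin (suc n)
  e′ zero    = zero
  e′ (suc i) = suc (e i)
  inj′ : ∀ {i j} → e′ i ≡ e′ j → i ≡ j
  inj′ {zero}  {zero}  _  = refl
  inj′ {suc i} {suc j} eq = cong suc (inj (suc-injective eq))
  sound′ : ∀ i → P (e′ i)
  sound′ zero    = p₀
  sound′ (suc i) = sound i
  complete′ : ∀ {x} → P x → ∃ λ i → e′ i ≡ x
  complete′ {zero}  _ = zero , refl
  complete′ {suc x} p = suc (proj₁ (complete p)) , cong suc (proj₂ (complete p))

xor-xor-cancel : ∀ a b → a xor (a xor b) ≡ b
xor-xor-cancel false b = refl
xor-xor-cancel true  b = not-involutive b

does⇒ : ∀ {A : Set} (a? : Dec A) → does a? ≡ true → A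
does⇒ (yes a) _ = a

choose-sides : ∀ {m} {P : Fin m → Bool → Set} i₀ s → (∀ i → i ≢ i₀ → ∃ (P i)) →
  Σ (Fin m → Bool) λ t → t i₀ ≡ s × (∀ i → i ≢ i₀ → P i (t i))
choose-sides {m} {P} i₀ s f = t , t-i₀ , Pt
  where
  t : Fin m → Bool
  t i with i ≟ i₀
  ... | yes _   = s
  ... | no i≢i₀ = proj₁ (f i i≢i₀)
  t-i₀ : t i₀ ≡ s
  t-i₀ with i₀ ≟ i₀
  ... | yes _ = refl
  ... | no ¬p = contradiction refl ¬p
  Pt : ∀ i → i ≢ i₀ → P i (t i)
  Pt i i≢i₀ with i ≟ i₀
  ... | yes p   = contradiction p i≢i₀
  ... | no i≢i₀ = proj₂ (f i i≢i₀)

-- Edges as oriented pairs, and finite families of edges.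

infix 4 _∈_ _∈?_

-- An edge is a function from `Bool` to its two ends, so that `not` leads from one end to the other.
_∈_ : ∀ {n} → Fin n → (Bool → Fin n) → Set
v ∈ e = ∃ λ s → e s ≡ v

_∈?_ : ∀ {n} (v : Fin n) e → Dec (v ∈ e)
v ∈? e = ∃Bool? λ s → e s ≟ v

Joins : ∀ {n} → (Bool → Fin n) → Fin n → Fin n → Set
Joins e u v = ∃ λ s → e s ≡ u × e (not s) ≡ v

joins? : ∀ {n} (e : Bool → Fin n) u v → Dec (Joins e u v)
joins? e u v = ∃Bool? λ s → (e s ≟ u) ×-dec (e (not s) ≟ v)

Joins-sym : ∀ {n} {e : Bool → Fin n} {u v} → Joins e u v → Joins e v u
Joins-sym (false , p , q) = true , q , p
Joins-sym (true  , p , q) = false , q , p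

Joins-transfer : ∀ {n} {e f : Bool → Fin n} {u v} →
  Joins e u v → Joins f u v → Joins f (e false) (e true)
Joins-transfer (false , refl , refl) j = j
Joins-transfer (true  , refl , refl) j = Joins-sym j

∈-transfer : ∀ {n} {e f : Bool → Fin n} {u v a} →
  Joins e u v → Joins f u v → a ∈ e → a ∈ f
∈-transfer (false , refl , refl) (r , p , q) (false , refl) = r , p
∈-transfer (false , refl , refl) (r , p , q) (true  , refl) = not r , q
∈-transfer (true  , refl , refl) (r , p , q) (false , refl) = not r , q
∈-transfer (true  , refl , refl) (r , p , q) (true  , refl) = r , p

⟨_,_⟩ : ∀ {n} → Fin n → Fin n → Bool → Fin n
⟨ u , v ⟩ false = u
⟨ u , v ⟩ true  = v

-- Counts ends, so a loop would contribute 2; looplessness is what gives the bound 1 below.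
incidence : ∀ {n} → (Bool → Fin n) → Fin n → ℕ
incidence e w = indicator (does (e false ≟ w)) + indicator (does (e true ≟ w))

incidence-∉ : ∀ {n} (e : Bool → Fin n) {w} → ¬ w ∈ e → incidence e w ≡ 0
incidence-∉ e {w} w∉e
  rewrite dec-false (e false ≟ w) (w∉e ∘ (false ,_)) | dec-false (e true ≟ w) (w∉e ∘ (true ,_)) = refl

incidence≤1 : ∀ {n} (e : Bool → Fin n) → e false ≢ e true → ∀ w → incidence e w ≤ 1
incidence≤1 e e₀≢e₁ w with e false ≟ w | e true ≟ w
... | yes p | yes q = contradiction (trans p (sym q)) e₀≢e₁
... | yes p | no  _ = ≤-refl
... | no  _ | yes _ = ≤-refl
... | no  _ | no  _ = z≤n

degree : ∀ {n N} → (Fin N → Bool → Fin n) → Fin n → ℕ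
degree es w = sumF λ i → incidence (es i) w

edge? : ∀ {n N} (es : Fin N → Bool → Fin n) u v → Dec (∃ λ i → Joins (es i) u v)
edge? es u v = any? λ i → joins? (es i) u v

-- Each edge of the family contributes at most one neighbour of `w` for each of its ends equal to
-- `w`. Repeated edges are counted once on the left, hence only an inequality.
countF-edge? : ∀ {n N} (es : Fin N → Bool → Fin n) w →
  countF (λ v → does (edge? es w v)) ≤ degree es w
countF-edge? {n} {zero}  es w = ≤-reflexive (sumF-zero {n} λ _ → refl)
countF-edge? {n} {suc N} es w =
  ≤-trans (countF-∨ (λ v → does (joins? (es zero) w v)) (λ v → does (edge? (es ∘ suc) w v)))
  (+-mono-≤
    (≤-trans (countF-∨ (λ v → does (es zero false ≟ w) ∧ does (es zero true ≟ v))
                       (λ v → does (es zero true ≟ w) ∧ does (es zero false ≟ v)))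
             (+-mono-≤ (countF-∧-≟ (does (es zero false ≟ w)) (es zero true))
                       (countF-∧-≟ (does (es zero true ≟ w)) (es zero false))))
    (countF-edge? (es ∘ suc) w))

Distinct : ∀ {n N} → (Fin N → Bool → Fin n) → Set
Distinct es = ∀ {i j u v} → Joins (es i) u v → Joins (es j) u v → i ≡ j

-- By induction: the first edge contributes at least one pair, and `Distinct` keeps its pairs
-- disjoint from those of the remaining edges.
N≤pairCount-edge? : ∀ {n N} (es : Fin N → Bool → Fin n) →
  (∀ i → es i false ≢ es i true) → Distinct es → N ≤ pairCount (λ u v → does (edge? es u v))
N≤pairCount-edge? {N = zero}  es loopless distinct = z≤n
N≤pairCount-edge? {N = suc N} es loopless distinct =
  ≤-trans (+-mono-≤
      (1≤pairCount first (loopless zero)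
        (dec-true (joins? (es zero) _ _) (false , refl , refl))
        (dec-true (joins? (es zero) _ _) (true , refl , refl)))
      (N≤pairCount-edge? (es ∘ suc) (loopless ∘ suc) λ p q → suc-injective (distinct p q)))
    (pairCount-disjoint-∨ {p = first} λ u v p q →
      clash (does⇒ (joins? (es zero) u v) p) (does⇒ (edge? (es ∘ suc) u v) q))
  where
  first : _ → _ → Bool
  first u v = does (joins? (es zero) u v)
  clash : ∀ {u v} → Joins (es zero) u v → ¬ (∃ λ i → Joins (es (suc i)) u v)
  clash p (i , q) with () ← distinct p q

-- The tree as a spider.

-- All legs of length two are treated alike here. In `TV` two of them are singled out as the halves
-- of the path `v₀ … v₄` with middle `v₂`, which is why `2 + s` legs correspond to the parameter
-- `s`.
data Spider (ℓ t : ℕ) : Set where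
  centre : Spider ℓ t
  inner  : Fin ℓ → Spider ℓ t
  outer  : Fin ℓ → Spider ℓ t
  leaf   : Fin t → Spider ℓ t

adjS : ∀ {ℓ t} → Spider ℓ t → Spider ℓ t → Bool
adjS centre    (inner _) = true
adjS (inner _) centre    = true
adjS centre    (leaf _)  = true
adjS (leaf _)  centre    = true
adjS (inner i) (outer j) = ⌊ i ≟ j ⌋
adjS (outer i) (inner j) = ⌊ i ≟ j ⌋
adjS _         _         = false

Fin5-cases : (P : Fin 5 → Set) → P zero → P (suc zero) → P (suc (suc zero)) →
  P (suc (suc (suc zero))) → P (suc (suc (suc (suc zero)))) → ∀ i → P i
Fin5-cases P a b c d e zero                         = a
Fin5-cases P a b c d e (suc zero)                   = b
Fin5-cases P a b c d e (suc (suc zero))             = c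
Fin5-cases P a b c d e (suc (suc (suc zero)))       = d
Fin5-cases P a b c d e (suc (suc (suc (suc zero)))) = e

module _ {s t : ℕ} where

  toSpider : TV s t → Spider (2 + s) t
  toSpider (vv zero)                         = outer zero
  toSpider (vv (suc zero))                   = inner zero
  toSpider (vv (suc (suc zero)))             = centre
  toSpider (vv (suc (suc (suc zero))))       = inner (suc zero)
  toSpider (vv (suc (suc (suc (suc zero))))) = outer (suc zero)
  toSpider (pv i)                            = inner (suc (suc i))
  toSpider (qv i)                            = outer (suc (suc i))
  toSpider (wv i)                            = leaf i

  fromSpider : Spider (2 + s) t → TV s t
  fromSpider (outer zero)          = vv zero
  fromSpider (inner zero)          = vv (suc zero)
  fromSpider centre                = vv (suc (suc zero))
  fromSpider (inner (suc zero))    = vv (suc (suc (suc zero)))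
  fromSpider (outer (suc zero))    = vv (suc (suc (suc (suc zero))))
  fromSpider (inner (suc (suc i))) = pv i
  fromSpider (outer (suc (suc i))) = qv i
  fromSpider (leaf i)              = wv i

  from-toSpider : ∀ x → fromSpider (toSpider x) ≡ x
  from-toSpider (vv i) =
    Fin5-cases (λ i → fromSpider (toSpider (vv i)) ≡ vv i) refl refl refl refl refl i
  from-toSpider (pv i) = refl
  from-toSpider (qv i) = refl
  from-toSpider (wv i) = refl

  to-fromSpider : ∀ x → toSpider (fromSpider x) ≡ x
  to-fromSpider (outer zero)          = refl
  to-fromSpider (inner zero)          = refl
  to-fromSpider centre                = refl
  to-fromSpider (inner (suc zero))    = refl
  to-fromSpider (outer (suc zero))    = refl
  to-fromSpider (inner (suc (suc i))) = refl
  to-fromSpider (outer (suc (suc i))) = refl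
  to-fromSpider (leaf i)              = refl

  ⌊≟⌋-suc² : ∀ {n} (i j : Fin n) → ⌊ suc (suc i) ≟ suc (suc j) ⌋ ≡ ⌊ i ≟ j ⌋
  ⌊≟⌋-suc² i j = trans (isYes≗does (suc (suc i) ≟ suc (suc j))) (sym (isYes≗does (i ≟ j)))

  adjS-toSpider : ∀ x y → adjS (toSpider x) (toSpider y) ≡ Tadj s t x y
  adjS-toSpider (vv i) (vv j) = Fin5-cases
    (λ i → ∀ j → adjS (toSpider (vv i)) (toSpider (vv j)) ≡ Tadj s t (vv i) (vv j))
    (Fin5-cases (λ j → adjS (outer zero) (toSpider (vv j)) ≡ _) refl refl refl refl refl)
    (Fin5-cases (λ j → adjS (inner zero) (toSpider (vv j)) ≡ _) refl refl refl refl refl)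
    (Fin5-cases (λ j → adjS centre (toSpider (vv j)) ≡ _) refl refl refl refl refl)
    (Fin5-cases (λ j → adjS (inner (suc zero)) (toSpider (vv j)) ≡ _) refl refl refl refl refl)
    (Fin5-cases (λ j → adjS (outer (suc zero)) (toSpider (vv j)) ≡ _) refl refl refl refl refl)
    i j
  adjS-toSpider (vv i) (pv _) =
    Fin5-cases (λ i → adjS (toSpider (vv i)) (inner _) ≡ is2 i) refl refl refl refl refl i
  adjS-toSpider (vv i) (qv _) =
    Fin5-cases (λ i → adjS (toSpider (vv i)) (outer _) ≡ false) refl refl refl refl refl i
  adjS-toSpider (vv i) (wv _) =
    Fin5-cases (λ i → adjS (toSpider (vv i)) (leaf _) ≡ is2 i) refl refl refl refl refl i
  adjS-toSpider (pv _) (vv j) =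
    Fin5-cases (λ j → adjS (inner _) (toSpider (vv j)) ≡ is2 j) refl refl refl refl refl j
  adjS-toSpider (qv _) (vv j) =
    Fin5-cases (λ j → adjS (outer _) (toSpider (vv j)) ≡ false) refl refl refl refl refl j
  adjS-toSpider (wv _) (vv j) =
    Fin5-cases (λ j → adjS (leaf _) (toSpider (vv j)) ≡ is2 j) refl refl refl refl refl j
  adjS-toSpider (pv _) (pv _) = refl
  adjS-toSpider (pv i) (qv j) = ⌊≟⌋-suc² i j
  adjS-toSpider (pv _) (wv _) = refl
  adjS-toSpider (qv i) (pv j) = ⌊≟⌋-suc² i j
  adjS-toSpider (qv _) (qv _) = refl
  adjS-toSpider (qv _) (wv _) = refl
  adjS-toSpider (wv _) (pv _) = refl
  adjS-toSpider (wv _) (qv _) = refl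
  adjS-toSpider (wv _) (wv _) = refl

-- Adjacency, 2-packings from families of edges, and small non-dominating sets.

module _ (G : Graph) where

  private
    V : Set
    V = Fin (n G)

  infix 4 _~_

  _~_ : V → V → Set
  u ~ v = adj G u v ≡ true

  ~-sym : ∀ {u v} → u ~ v → v ~ u
  ~-sym {u} {v} = trans (adj-sym G v u)

  ~⇒≢ : ∀ {u v} → u ~ v → u ≢ v
  ~⇒≢ {u} u~u refl with () ← trans (sym u~u) (adj-irr G u)

  _~?_ : ∀ u v → Dec (u ~ v)
  u ~? v = adj G u v ≟B true

  Joins-~ : ∀ {e u v} → e false ~ e true → Joins e u v → u ~ v
  Joins-~ e~ (false , refl , refl) = e~
  Joins-~ e~ (true  , refl , refl) = ~-sym e~

  edgesOf : ∀ {N} (es : Fin N → Bool → V) → (∀ i → es i false ~ es i true) → EdgeSubset G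
  edgesOf es es~ = record
    { R     = λ u v → does (edge? es u v)
    ; R-sym = λ u v → does-⇔ (mk⇔ flip flip) (edge? es u v) (edge? es v u)
    ; R-sub = λ u v r → let (i , j) = does⇒ (edge? es u v) r in Joins-~ (es~ i) j
    }
    where
    flip : ∀ {u v} → (∃ λ i → Joins (es i) u v) → ∃ λ i → Joins (es i) v u
    flip (i , j) = i , Joins-sym j

  packing-bound : ∀ {k} → (∀ (S : EdgeSubset G) → Is2Packing G S → esize S ≤ k) →
    ∀ {N} (es : Fin N → Bool → V) → (∀ i → es i false ~ es i true) → Distinct es →
    (∀ w → degree es w ≤ 2) → N ≤ k
  packing-bound bound es es~ distinct deg≤2 =
    ≤-trans (N≤pairCount-edge? es (~⇒≢ ∘ es~) distinct)
            (bound (edgesOf es es~) λ w → ≤-trans (countF-edge? es w) (deg≤2 w))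

  -- The image of `f` has at most `j` elements, fewer than any dominating set.
  undominated : ∀ {k} → (∀ D → IsDominating G D → k ≤ countF D) →
    ∀ {j} → j < k → (f : Fin j → V) → ∃ λ v → ∀ i → f i ≢ v × ¬ v ~ f i
  undominated bound j<k f with all? dominated?
    where
    dominated? : ∀ v → Dec (∃ λ i → f i ≡ v ⊎ v ~ f i)
    dominated? v = any? λ i → (f i ≟ v) ⊎-dec (v ~? f i)
  ... | yes dom = contradiction
    (≤-trans (bound (image f) λ v → in-image v (dom v)) (countF-image f)) (<⇒≱ j<k)
    where
    hit : ∀ i → image f (f i) ≡ true
    hit i = dec-true (any? _) (i , refl)
    in-image : ∀ v → (∃ λ i → f i ≡ v ⊎ v ~ f i) →
      image f v ≡ true ⊎ (∃ λ u → v ~ u × image f u ≡ true)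
    in-image v (i , inj₁ refl) = inj₁ (hit i)
    in-image v (i , inj₂ v~fi) = inj₂ (f i , v~fi , hit i)
  ... | no ¬dom with v , ¬d ← ¬∀⟶∃¬ _ _ (λ v → any? λ i → (f i ≟ v) ⊎-dec (v ~? f i)) ¬dom =
    v , λ i → (λ p → ¬d (i , inj₁ p)) , λ q → ¬d (i , inj₂ q)

  -- Matchings and their modification.

  record Matching (m : ℕ) : Set where
    field
      end           : Fin m → Bool → V
      end-injective : ∀ {i j s r} → end i s ≡ end j r → i ≡ j × s ≡ r
      end-~         : ∀ i → end i false ~ end i true

    Covered : V → Set
    Covered v = ∃ λ i → v ∈ end i

    covered? : ∀ v → Dec (Covered v)
    covered? v = any? λ i → v ∈? end i

    end-~-not : ∀ i s → end i s ~ end i (not s)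
    end-~-not i false = end-~ i
    end-~-not i true  = ~-sym (end-~ i)

    degree-uncovered : ∀ {w} → ¬ Covered w → degree end w ≡ 0
    degree-uncovered ¬c = sumF-zero λ i → incidence-∉ (end i) (¬c ∘ (i ,_))

    degree≤1 : ∀ w → degree end w ≤ 1
    degree≤1 w with covered? w
    ... | no ¬c = ≤-trans (≤-reflexive (degree-uncovered ¬c)) z≤n
    -- Matching edges are disjoint, so only the summand of edge `i` can be nonzero.
    ... | yes (i , s , refl) = ≤-trans (sumF-mono bound) (countF-≟ i)
      where
      bound : ∀ j → incidence (end j) w ≤ indicator (does (i ≟ j))
      bound j with i ≟ j
      ... | yes refl = incidence≤1 (end i) (~⇒≢ (end-~ i)) w
      ... | no i≢j   = ≤-reflexive (incidence-∉ (end j) λ { (r , eq) →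
                         i≢j (sym (proj₁ (end-injective eq))) })

  open Matching

  emptyMatching : Matching 0
  emptyMatching = record { end = λ () ; end-injective = λ { {()} } ; end-~ = λ () }

  extend : ∀ {m} (M : Matching m) {u v} → u ~ v → ¬ Covered M u → ¬ Covered M v → Matching (suc m)
  extend {m} M {u} {v} u~v ¬u ¬v = record { end = end′ ; end-injective = inj ; end-~ = end′-~ }
    where
    end′ : Fin (suc m) → Bool → V
    end′ zero    = ⟨ u , v ⟩
    end′ (suc i) = end M i
    new-uncovered : ∀ s → ¬ Covered M (⟨ u , v ⟩ s)
    new-uncovered false = ¬u
    new-uncovered true  = ¬v
    inj : ∀ {i j s r} → end′ i s ≡ end′ j r → i ≡ j × s ≡ r
    inj {zero} {zero} {false} {false} _ = refl , refl
    inj {zero} {zero} {false} {true} eq = contradiction eq (~⇒≢ u~v)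
    inj {zero} {zero} {true} {false} eq = contradiction (sym eq) (~⇒≢ u~v)
    inj {zero} {zero} {true} {true} _ = refl , refl
    inj {zero} {suc j} {s} {r} eq = contradiction (j , r , sym eq) (new-uncovered s)
    inj {suc i} {zero} {s} {r} eq = contradiction (i , s , eq) (new-uncovered r)
    inj {suc i} {suc j} eq with refl , s≡r ← end-injective M eq = refl , s≡r
    end′-~ : ∀ i → end′ i false ~ end′ i true
    end′-~ zero    = u~v
    end′-~ (suc i) = end-~ M i

  module _ {m} (M : Matching m) (i : Fin m) (s : Bool) {u : V}
           (¬u : ¬ Covered M u) (u~ : u ~ end M i (not s)) where

    private
      end′ : Fin m → Bool → V
      end′ j r with j ≟ i | r ≟B s
      ... | yes _ | yes _ = u
      ... | _     | _     = end M j r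

      end′-cases : ∀ j r → (j ≡ i × r ≡ s × end′ j r ≡ u)
                         ⊎ (¬ (j ≡ i × r ≡ s) × end′ j r ≡ end M j r)
      end′-cases j r with j ≟ i | r ≟B s
      ... | yes p | yes q = inj₁ (p , q , refl)
      ... | yes _ | no ¬q = inj₂ (¬q ∘ proj₂ , refl)
      ... | no ¬p | yes _ = inj₂ (¬p ∘ proj₁ , refl)
      ... | no ¬p | no _  = inj₂ (¬p ∘ proj₁ , refl)

      inj : ∀ {j k r t} → end′ j r ≡ end′ k t → j ≡ k × r ≡ t
      inj {j} {k} {r} {t} eq with end′-cases j r | end′-cases k t
      ... | inj₁ (refl , refl , _) | inj₁ (refl , refl , _) = refl , refl
      ... | inj₁ (_ , _ , a) | inj₂ (_ , b) =
        contradiction (k , t , trans (sym b) (trans (sym eq) a)) ¬u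
      ... | inj₂ (_ , a) | inj₁ (_ , _ , b) =
        contradiction (j , r , trans (sym a) (trans eq b)) ¬u
      ... | inj₂ (_ , a) | inj₂ (_ , b) = end-injective M (trans (sym a) (trans eq b))

      end′-~ : ∀ j → end′ j false ~ end′ j true
      end′-~ j with end′-cases j false | end′-cases j true
      ... | inj₁ (_ , refl , _) | inj₁ (_ , () , _)
      ... | inj₁ (refl , refl , a) | inj₂ (_ , b) = subst₂ _~_ (sym a) (sym b) u~
      ... | inj₂ (_ , a) | inj₁ (refl , refl , b) = subst₂ _~_ (sym a) (sym b) (~-sym u~)
      ... | inj₂ (_ , a) | inj₂ (_ , b) = subst₂ _~_ (sym a) (sym b) (end-~ M j)

    -- Edge `i` keeps its other end and takes `u` in place of `end M i s`, which is thereby freed.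
    -- This is the first half of augmenting along a path of length 3.
    exchange : Matching m
    exchange = record { end = end′ ; end-injective = inj ; end-~ = end′-~ }

    exchange-uncovers : ¬ Covered exchange (end M i s)
    exchange-uncovers (j , r , eq) with end′-cases j r
    ... | inj₁ (_ , _ , a) = ¬u (i , s , trans (sym eq) a)
    ... | inj₂ (¬p , a)    = ¬p (end-injective M (trans (sym a) eq))

    exchange-keeps-uncovered : ∀ {v} → ¬ Covered M v → v ≢ u → ¬ Covered exchange v
    exchange-keeps-uncovered ¬v v≢u (j , r , eq) with end′-cases j r
    ... | inj₁ (_ , _ , a) = v≢u (trans (sym eq) a)
    ... | inj₂ (_ , a)     = ¬v (j , r , trans (sym a) eq)

  -- A matching with as many edges as the domination number.

  same-or-mate : ∀ {m} (M : Matching m) i r s → end M i r ≡ end M i s ⊎ end M i s ~ end M i r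
  same-or-mate M i false false = inj₁ refl
  same-or-mate M i false true  = inj₂ (end-~-not M i true)
  same-or-mate M i true  false = inj₂ (end-~-not M i false)
  same-or-mate M i true  true  = inj₁ refl

  module _ {m} (M : Matching m) where

    free? : ∀ x → Dec (∃ λ u → x ~ u × ¬ Covered M u)
    free? x = any? λ u → (x ~? u) ×-dec ¬? (covered? M u)

    -- From each matching edge choose an endpoint, preferring one with an uncovered neighbour.
    choice : Fin m → V
    choice i = end M i (not (does (free? (end M i false))))

    -- A vertex that the choice does not dominate ends an augmenting path of length 1 or 3.
    augment : (∀ v → ∃ λ w → v ~ w) → ∀ v → (∀ i → choice i ≢ v × ¬ v ~ choice i) →
      Matching (suc m)
    augment neighbour v far with covered? M v
    -- A covered `v` is the chosen end of its matching edge or the mate of that end, so it is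
    -- dominated.
    ... | yes (i , s , refl) with same-or-mate M i (not (does (free? (end M i false)))) s
    ...   | inj₁ eq = contradiction eq (proj₁ (far i))
    ...   | inj₂ e  = contradiction e (proj₂ (far i))
    augment neighbour v far | no ¬v with neighbour v
    ... | w , v~w with covered? M w
    ... | no ¬w = extend M v~w ¬v ¬w
    ... | yes (i , s , refl) with free? (end M i false) | far i | s
    ... | yes _    | _ , ¬near | false = contradiction v~w ¬near
    ... | no _     | _ , ¬near | true  = contradiction v~w ¬near
    -- Here `w` is the end `false`, passed over for lack of an uncovered neighbour, yet `v` is one.
    ... | no ¬free | _         | false = contradiction (v , ~-sym v~w , ¬v) ¬free
    -- The augmenting path runs from `u` to the chosen end, along the matching edge to `w`, and on
    -- to `v`. It is a path because `v` is not adjacent to the chosen end, so `u` differs from `v`.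
    ... | yes (u , p~u , ¬u) | _ , ¬near | true =
      extend (exchange M i true ¬u (~-sym p~u)) (~-sym v~w)
        (exchange-uncovers M i true ¬u (~-sym p~u))
        (exchange-keeps-uncovered M i true ¬u (~-sym p~u) ¬v λ { refl → ¬near (~-sym p~u) })

  matching-of-size : ∀ {k} → (∀ v → ∃ λ w → v ~ w) → (∀ D → IsDominating G D → k ≤ countF D) →
    ∀ {m} → m ≤ k → Matching m
  matching-of-size nb bound {zero}  _   = emptyMatching
  matching-of-size nb bound {suc m} m<k =
    let M       = matching-of-size nb bound (<⇒≤ m<k)
        v , far = undominated bound m<k (choice M)
    in augment M nb v far

  -- Edges outside the matching form a star.

  -- The walk must cross from `P` to its complement somewhere. All uses of connectivity go through
  -- such a crossing edge.
  exit : ∀ {P : V → Set} → (∀ v → Dec (P v)) → ∀ {u v} → Walk G u v → P u → ¬ P v →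
    ∃₂ λ x y → x ~ y × P x × ¬ P y
  exit P? here Pu ¬Pu = contradiction Pu ¬Pu
  exit P? (step {u} {w} u~w walk) Pu ¬Pv with P? w
  ... | yes Pw = exit P? walk Pw ¬Pv
  ... | no ¬Pw = u , w , u~w , Pu , ¬Pw

  has-neighbour : Connected G → ∀ {v w} → w ≢ v → ∃ λ x → v ~ x
  has-neighbour conn {v} {w} w≢v with _ , y , x~y , refl , _ ← exit (_≟ v) (conn v w) refl w≢v = y , x~y

  Unmatched : ∀ {m} → Matching m → (Bool → V) → Set
  Unmatched M e = ∀ i → ¬ Joins (end M i) (e false) (e true)

  -- Otherwise adding both edges to the matching would give a 2-packing of size 2 + m.
  unmatched-edges-meet : ∀ {m} → (∀ (S : EdgeSubset G) → Is2Packing G S → esize S ≤ suc m) →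
    (M : Matching m) (e f : Bool → V) → e false ~ e true → f false ~ f true →
    Unmatched M e → Unmatched M f → ∀ {a} → a ∈ e → ¬ a ∈ f →
    ∃ λ v → Covered M v × v ∈ e × v ∈ f
  unmatched-edges-meet {m} bound M e f e~ f~ ¬Me ¬Mf a∈e a∉f
    with any? (λ v → covered? M v ×-dec ((v ∈? e) ×-dec (v ∈? f)))
  ... | yes meet = meet
  ... | no ¬meet = contradiction (packing-bound bound es es~ distinct deg≤2) 1+n≰n
    where
    es : Fin (2 + m) → Bool → V
    es zero          = e
    es (suc zero)    = f
    es (suc (suc i)) = end M i
    es~ : ∀ i → es i false ~ es i true
    es~ zero          = e~
    es~ (suc zero)    = f~
    es~ (suc (suc i)) = end-~ M i
    distinct : Distinct es
    distinct {zero} {zero} _ _ = refl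
    -- The vertex `a`, on `e` but not on `f`, tells the two added edges apart.
    distinct {zero} {suc zero} p q = contradiction (∈-transfer {e = e} {f} p q a∈e) a∉f
    distinct {zero} {suc (suc j)} p q =
      contradiction (Joins-transfer {e = e} {end M j} p q) (¬Me j)
    distinct {suc zero} {zero} p q = contradiction (∈-transfer {e = e} {f} q p a∈e) a∉f
    distinct {suc zero} {suc zero} _ _ = refl
    distinct {suc zero} {suc (suc j)} p q =
      contradiction (Joins-transfer {e = f} {end M j} p q) (¬Mf j)
    distinct {suc (suc i)} {zero} p q =
      contradiction (Joins-transfer {e = e} {end M i} q p) (¬Me i)
    distinct {suc (suc i)} {suc zero} p q =
      contradiction (Joins-transfer {e = f} {end M i} q p) (¬Mf i)
    distinct {suc (suc i)} {suc (suc j)} p q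
      with r , eq ← ∈-transfer {e = end M i} {end M j} p q (false , refl) =
      cong (λ x → suc (suc x)) (sym (proj₁ (end-injective M eq)))
    e≤1 : ∀ w → incidence e w ≤ 1
    e≤1 = incidence≤1 e (~⇒≢ e~)
    f≤1 : ∀ w → incidence f w ≤ 1
    f≤1 = incidence≤1 f (~⇒≢ f~)
    deg≤2 : ∀ w → degree es w ≤ 2
    -- A vertex gets at most one from each of `e`, `f` and the matching; all three at once would
    -- make it a covered common vertex of `e` and `f`.
    deg≤2 w with w ∈? e | w ∈? f | covered? M w
    ... | no ¬e | _ | _ rewrite incidence-∉ e ¬e = +-mono-≤ (f≤1 w) (degree≤1 M w)
    ... | yes _ | no ¬f | _ rewrite incidence-∉ f ¬f = +-mono-≤ (e≤1 w) (degree≤1 M w)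
    ... | yes _ | yes _ | no ¬c rewrite degree-uncovered M ¬c =
      +-mono-≤ (e≤1 w) (+-mono-≤ (f≤1 w) z≤n)
    ... | yes we | yes wf | yes c = contradiction (w , c , we , wf) ¬meet

  -- Matching edges are disjoint, so `j` vertices touch at most `j` of them; otherwise two edges
  -- would share one of the vertices by the pigeonhole principle.
  fresh-edge : ∀ {m j} (M : Matching m) → j < m → (vs : Fin j → V) →
    ∃ λ l → ∀ i → ¬ vs i ∈ end M l
  fresh-edge {m} {j} M j<m vs with any? (λ l → ¬? (any? λ i → vs i ∈? end M l))
  ... | yes (l , fresh) = l , λ i p → fresh (i , p)
  ... | no ¬fresh = ⊥-elim (clash (pigeonhole j<m (proj₁ ∘ touched)))
    where
    touched : ∀ l → ∃ λ i → vs i ∈ end M l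
    touched l = decidable-stable (any? λ i → vs i ∈? end M l) λ ¬t → ¬fresh (l , ¬t)
    clash : ¬ (∃₂ λ l l′ → l <F l′ × proj₁ (touched l) ≡ proj₁ (touched l′))
    clash (l , l′ , l<l′ , eq) with touched l | touched l′
    ... | i , r , p | i′ , r′ , q =
      F<⇒≢ l<l′ (proj₁ (end-injective M (trans p (trans (cong vs eq) (sym q)))))

  -- A walk to an end of a second matching edge, which exists as `2 ≤ m`, has to leave edge `i`.
  leaving : Connected G → ∀ {m} (M : Matching m) → 2 ≤ m →
    ∀ i → ∃₂ λ p y → p ∈ end M i × p ~ y × ¬ y ∈ end M i
  leaving conn M 2≤m i with fresh-edge {j = 1} M 2≤m (λ _ → end M i false)
  ... | l , fresh with exit (_∈? end M i) (conn (end M i false) (end M l false)) (false , refl) outside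
    where
    outside : ¬ end M l false ∈ end M i
    outside (s , eq) with refl , _ ← end-injective M eq = fresh zero (false , refl)
  ... | p , y , p~y , p∈ , y∉ = p , y , p∈ , p~y , y∉

  leaving-unmatched : ∀ {m} (M : Matching m) {i p y} → p ∈ end M i → ¬ y ∈ end M i →
    Unmatched M ⟨ p , y ⟩
  leaving-unmatched M (s , refl) y∉ j (r , eq , eq′)
    with refl , _ ← end-injective M eq = y∉ (not r , eq′)

  two-ends : ∀ {e : Bool → V} {a b c} → a ∈ e → b ∈ e → c ∈ e → a ≡ b ⊎ a ≡ c ⊎ b ≡ c
  two-ends (false , p) (false , q) _           = inj₁ (trans (sym p) q)
  two-ends (true  , p) (true  , q) _           = inj₁ (trans (sym p) q)
  two-ends (false , p) (true  , q) (false , r) = inj₂ (inj₁ (trans (sym p) r))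
  two-ends (false , p) (true  , q) (true  , r) = inj₂ (inj₂ (trans (sym q) r))
  two-ends (true  , p) (false , q) (true  , r) = inj₂ (inj₁ (trans (sym p) r))
  two-ends (true  , p) (false , q) (false , r) = inj₂ (inj₂ (trans (sym q) r))

  StarCentre : ∀ {m} → Matching m → V → Set
  StarCentre M c = ∀ {u v} → u ~ v → (∃ λ i → Joins (end M i) u v) ⊎ u ≡ c ⊎ v ≡ c

  module _ (conn : Connected G) {m} (bound : ∀ (S : EdgeSubset G) → Is2Packing G S → esize S ≤ suc m)
           (4≤m : 4 ≤ m) (M : Matching m) where

    private
      Spoke : (Bool → V) → Fin m → Set
      Spoke e l = ∃₂ λ p z → p ∈ end M l × p ~ z × Unmatched M ⟨ p , z ⟩ × z ∈ e × Covered M z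

    -- The edge leaving matching edge `l` shares a covered vertex with `e`. Since `e` avoids edge
    -- `l`, that vertex is the far end `z`.
    spoke : ∀ {e} → e false ~ e true → Unmatched M e → ∀ l → (∀ {v} → v ∈ e → ¬ v ∈ end M l) →
      Spoke e l
    spoke {e} e~ ¬Me l avoids
      with p , z , p∈ , p~z , z∉ ← leaving conn M (≤-trans (s≤s (s≤s z≤n)) 4≤m) l
      with unmatched-edges-meet bound M ⟨ p , z ⟩ e p~z e~ (leaving-unmatched M p∈ z∉) ¬Me
             (false , refl) (λ p∈e → avoids p∈e p∈)
    ... | v , _ , (false , refl) , v∈e = contradiction p∈ (avoids v∈e)
    ... | v , c , (true , refl) , v∈e  = p , z , p∈ , p~z , leaving-unmatched M p∈ z∉ , v∈e , c

    -- The two spokes start on different matching edges, so they can only share their far end `z`,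
    -- and this is the centre.
    spokes-meet-in-centre : ∀ {e} → e false ~ e true → Unmatched M e → ∀ {l l′} → l ≢ l′ →
      (∀ {v} → v ∈ e → ¬ v ∈ end M l) → (∀ {v} → v ∈ e → ¬ v ∈ end M l′) →
      Spoke e l → Spoke e l′ → ∃ λ c → Covered M c × StarCentre M c
    spokes-meet-in-centre {e} e~ ¬Me {l} {l′} l≢l′ avoids avoids′
      (p , z , p∈ , p~z , ¬Mp , z∈ , z-cov) (p′ , z′ , p′∈ , p′~z′ , ¬Mp′ , z′∈ , _) =
      z , z-cov , star
      where
      p≢p′ : p ≢ p′
      p≢p′ p≡p′ = l≢l′ (proj₁ (end-injective M (trans (proj₂ p∈) (trans p≡p′ (sym (proj₂ p′∈))))))

      p∉spoke′ : ¬ p ∈ ⟨ p′ , z′ ⟩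
      p∉spoke′ (false , refl) = p≢p′ refl
      p∉spoke′ (true  , refl) = avoids z′∈ p∈

      z≡z′ : z ≡ z′
      z≡z′ with unmatched-edges-meet bound M ⟨ p , z ⟩ ⟨ p′ , z′ ⟩ p~z p′~z′ ¬Mp ¬Mp′
                  (false , refl) p∉spoke′
      ... | _ , _ , (false , refl) , v∈         = contradiction v∈ p∉spoke′
      ... | _ , _ , (true , refl) , false , refl = contradiction p′∈ (avoids′ z∈)
      ... | _ , _ , (true , refl) , true , eq    = sym eq

      other-end∈ : ∀ {q f} → q ~ z → Unmatched M ⟨ q , z ⟩ → f false ~ f true → Unmatched M f →
        ¬ z ∈ f → q ∈ f
      other-end∈ {q} {f} q~z ¬Mq f~ ¬Mf z∉f
        with unmatched-edges-meet bound M ⟨ q , z ⟩ f q~z f~ ¬Mq ¬Mf (true , refl) z∉f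
      ... | _ , _ , (false , refl) , v∈ = v∈
      ... | _ , _ , (true  , refl) , v∈ = contradiction v∈ z∉f

      contains-z : ∀ {f} → f false ~ f true → Unmatched M f → z ∈ f
      contains-z {f} f~ ¬Mf with z ∈? f
      ... | yes z∈f = z∈f
      ... | no z∉f
        with v , _ , v∈e , v∈f ← unmatched-edges-meet bound M e f e~ f~ ¬Me ¬Mf z∈ z∉f
        -- Missing `z`, the edge `f` must meet both spokes in `p` and `p′` and meet `e` in `v`.
        -- These are three different vertices, one too many for an edge.
        with two-ends {f} (other-end∈ p~z ¬Mp f~ ¬Mf z∉f)
               (other-end∈ (subst (p′ ~_) (sym z≡z′) p′~z′)
                 (subst (λ y → Unmatched M ⟨ p′ , y ⟩) (sym z≡z′) ¬Mp′) f~ ¬Mf z∉f)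
               v∈f
      ... | inj₁ p≡p′       = contradiction p≡p′ p≢p′
      ... | inj₂ (inj₁ refl) = contradiction p∈ (avoids v∈e)
      ... | inj₂ (inj₂ refl) = contradiction p′∈ (avoids′ v∈e)

      star : StarCentre M z
      star {u} {v} u~v with any? (λ i → joins? (end M i) u v)
      ... | yes j = inj₁ j
      ... | no ¬j with contains-z {⟨ u , v ⟩} u~v (λ i j → ¬j (i , j))
      ... | false , u≡z = inj₂ (inj₁ u≡z)
      ... | true  , v≡z = inj₂ (inj₂ v≡z)

    centre-avoiding : ∀ {x y l l′} → x ~ y → Unmatched M ⟨ x , y ⟩ →
      (∀ j → ¬ lookup (x ∷ y ∷ []) j ∈ end M l) →
      (∀ j → ¬ lookup (x ∷ y ∷ end M l false ∷ []) j ∈ end M l′) →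
      ∃ λ c → Covered M c × StarCentre M c
    centre-avoiding {x} {y} {l} {l′} x~y ¬Me fresh fresh′ =
      spokes-meet-in-centre x~y ¬Me l≢l′ avoids avoids′
        (spoke x~y ¬Me l avoids) (spoke x~y ¬Me l′ avoids′)
      where
      l≢l′ : l ≢ l′
      l≢l′ refl = fresh′ (suc (suc zero)) (false , refl)
      avoids : ∀ {v} → v ∈ ⟨ x , y ⟩ → ¬ v ∈ end M l
      avoids (false , refl) = fresh zero
      avoids (true  , refl) = fresh (suc zero)
      avoids′ : ∀ {v} → v ∈ ⟨ x , y ⟩ → ¬ v ∈ end M l′
      avoids′ (false , refl) = fresh′ zero
      avoids′ (true  , refl) = fresh′ (suc zero)

    -- An unmatched edge e touches at most two matching edges.  Unmatched edges leaving two further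
    -- ones meet e in one and the same vertex, and an unmatched edge avoiding it would have three ends.
    unmatched-edges-form-star : ∃ λ c → Covered M c × StarCentre M c
    unmatched-edges-form-star with fresh-edge M (≤-trans (s≤s z≤n) 4≤m) (λ ())
    ... | i , _ with leaving conn M (≤-trans (s≤s (s≤s z≤n)) 4≤m) i
    ... | x , y , x∈ , x~y , y∉
      with fresh-edge M (≤-trans (s≤s (s≤s (s≤s z≤n))) 4≤m) (lookup (x ∷ y ∷ []))
    -- Avoiding an end of edge `l` too makes `l′` different from `l`. Three vertices to avoid
    -- require the fourth matching edge.
    ... | l , fresh with fresh-edge M 4≤m (lookup (x ∷ y ∷ end M l false ∷ []))
    ... | l′ , fresh′ = centre-avoiding x~y (leaving-unmatched M x∈ y∉) fresh fresh′

  -- Orienting the matching towards the centre.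

  relabel : ∀ {m} → Matching m → (Fin m → Bool) → Matching m
  relabel M t = record
    { end           = λ i s → end M i (t i xor s)
    ; end-injective = inj
    ; end-~         = λ i → relabelled-~ i (t i)
    }
    where
    inj : ∀ {i j s r} → end M i (t i xor s) ≡ end M j (t j xor r) → i ≡ j × s ≡ r
    inj {i} {s = s} {r} eq with refl , eq′ ← end-injective M eq =
      refl , trans (sym (xor-xor-cancel (t i) s)) (trans (cong (t i xor_) eq′) (xor-xor-cancel (t i) r))
    relabelled-~ : ∀ i a → end M i (a xor false) ~ end M i (a xor true)
    relabelled-~ i false = end-~ M i
    relabelled-~ i true  = ~-sym (end-~ M i)

  Joins-relabel : ∀ {m} (M : Matching m) t {i u v} →
    Joins (end M i) u v → Joins (end (relabel M t) i) u v
  Joins-relabel M t {i} (s , p , q) =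
    t i xor s ,
    trans (cong (end M i) (xor-xor-cancel (t i) s)) p ,
    trans (cong (end M i) (trans (cong (t i xor_) (not-distribʳ-xor (t i) s))
                                 (xor-xor-cancel (t i) (not s)))) q

  -- A normal form: the end `false` of the hub edge is the centre, and the end `false` of every
  -- other edge is the inner vertex of a future leg.
  record CentredMatching (m : ℕ) : Set where
    field
      M      : Matching m
      hub    : Fin m
      star   : StarCentre M (end M hub false)
      near   : ∀ l → l ≢ hub → end M l false ~ end M hub false

  -- An edge leaving matching edge `l` is unmatched and so contains the centre. The centre lies on
  -- the hub edge, hence it is the far end.
  attached-end : Connected G → ∀ {m} → 2 ≤ m → (M : Matching m) → ∀ {hub s} →
    StarCentre M (end M hub s) → ∀ l → l ≢ hub → ∃ λ r → end M l r ~ end M hub s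
  attached-end conn 2≤m M star l l≢hub with leaving conn M 2≤m l
  ... | p , y , (r , refl) , p~y , y∉ with star p~y
  ... | inj₁ (j , joins) = contradiction joins (leaving-unmatched M (r , refl) y∉ j)
  ... | inj₂ (inj₁ p≡c)  = contradiction (proj₁ (end-injective M p≡c)) l≢hub
  ... | inj₂ (inj₂ refl) = r , p~y

  recentre : ∀ {m} (M : Matching m) {hub s} → StarCentre M (end M hub s) → (t : Fin m → Bool) →
    t hub ≡ s → (∀ l → l ≢ hub → end M l (t l) ~ end M hub s) → CentredMatching m
  recentre M {hub} {s} star t t-hub near = record
    { M    = relabel M t
    ; hub  = hub
    ; star = recentred ∘ star
    ; near = λ l l≢hub → subst₂ _~_ (cong (end M l) (sym (xor-identityʳ (t l)))) (sym centre≡)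
                           (near l l≢hub)
    }
    where
    centre≡ : end M hub (t hub xor false) ≡ end M hub s
    centre≡ = cong (end M hub) (trans (xor-identityʳ (t hub)) t-hub)
    recentred : ∀ {u v} → (∃ λ i → Joins (end M i) u v) ⊎ u ≡ end M hub s ⊎ v ≡ end M hub s →
      (∃ λ i → Joins (end (relabel M t) i) u v)
        ⊎ u ≡ end M hub (t hub xor false) ⊎ v ≡ end M hub (t hub xor false)
    recentred (inj₁ (i , j))     = inj₁ (i , Joins-relabel M t j)
    recentred (inj₂ (inj₁ u≡c)) = inj₂ (inj₁ (trans u≡c (sym centre≡)))
    recentred (inj₂ (inj₂ v≡c)) = inj₂ (inj₂ (trans v≡c (sym centre≡)))

  centre-star : Connected G → ∀ {m} → 2 ≤ m → (M : Matching m) →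
    (∃ λ c → Covered M c × StarCentre M c) → CentredMatching m
  centre-star conn 2≤m M (_ , (hub , s , refl) , star) =
    let t , t-hub , near = choose-sides {P = λ l r → end M l r ~ end M hub s} hub s
                             (attached-end conn 2≤m M star)
    in recentre M star t t-hub near

  centred-matching : Connected G →
    ∀ {m} → (∀ (S : EdgeSubset G) → Is2Packing G S → esize S ≤ suc m) → 4 ≤ m → Matching m →
    CentredMatching m
  centred-matching conn bound 4≤m M =
    centre-star conn (≤-trans (s≤s (s≤s z≤n)) 4≤m) M (unmatched-edges-form-star conn bound 4≤m M)

  -- Reading off the spider.

  module _ {ℓ} (C : CentredMatching (suc ℓ)) (neighbour : ∀ v → ∃ λ w → v ~ w) where
    open CentredMatching C

    private
      c : V
      c = end M hub false

      c-covered : Covered M c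
      c-covered = hub , false , refl

    -- No edge at an uncovered vertex is a matching edge, so any such edge contains `c`, and `v`
    -- itself is not `c`.
    uncovered-~-centre : ∀ {v} → ¬ Covered M v → v ~ c
    uncovered-~-centre {v} ¬v with w , v~w ← neighbour v with star v~w
    ... | inj₁ (i , r , eq , _) = contradiction (i , r , eq) ¬v
    ... | inj₂ (inj₁ refl)      = contradiction c-covered ¬v
    ... | inj₂ (inj₂ refl)      = v~w

    -- If both ends of edge j are adjacent to the centre, the ends `false` of all other edges dominate.
    far : (∀ D → IsDominating G D → suc ℓ ≤ countF D) → ∀ j → j ≢ hub → ¬ end M j true ~ c
    far bound j j≢hub j~c
      with v , undom ← undominated bound ≤-refl (λ k → end M (punchIn j k) false)
      = contradiction-at v (covered? M v) λ {l} j≢l →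
          subst (λ k → end M k false ≢ v × ¬ v ~ end M k false) (punchIn-punchOut j≢l)
                (undom (punchOut j≢l))
      where
      contradiction-at : ∀ v → Dec (Covered M v) →
        (∀ {l} → j ≢ l → end M l false ≢ v × ¬ v ~ end M l false) → ⊥
      -- `undom j≢hub` concerns the centre, which remains among the chosen ends because `j` is not
      -- the hub.
      contradiction-at v (no ¬v) undom = proj₂ (undom j≢hub) (uncovered-~-centre ¬v)
      contradiction-at v (yes (l , s , refl)) undom with j ≟ l
      ... | no j≢l with same-or-mate M l false s
      ...   | inj₁ eq = proj₁ (undom j≢l) eq
      ...   | inj₂ e  = proj₂ (undom j≢l) e
      contradiction-at v (yes (l , false , refl)) undom | yes refl = proj₂ (undom j≢hub) (near j j≢hub)
      contradiction-at v (yes (l , true  , refl)) undom | yes refl = proj₂ (undom j≢hub) j~c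

    -- The mate of the centre hangs on the centre just as the uncovered vertices do. It also
    -- guarantees that there is at least one leaf.
    Leaf : V → Set
    Leaf v = end M hub true ≡ v ⊎ ¬ Covered M v

    leaf? : ∀ v → Dec (Leaf v)
    leaf? v = (end M hub true ≟ v) ⊎-dec ¬? (covered? M v)

    leaf-~-centre : ∀ {v} → Leaf v → c ~ v
    leaf-~-centre (inj₁ refl) = end-~ M hub
    leaf-~-centre (inj₂ ¬v)   = ~-sym (uncovered-~-centre ¬v)

    leaf≢centre : ∀ {v} → Leaf v → v ≢ c
    leaf≢centre lf refl = ~⇒≢ (leaf-~-centre lf) refl

    leaf-neighbour : ∀ {u v} → Leaf u → u ~ v → v ≡ c
    leaf-neighbour lf u~v with star u~v
    ... | inj₂ (inj₁ u≡c) = contradiction u≡c (leaf≢centre lf)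
    ... | inj₂ (inj₂ v≡c) = v≡c
    leaf-neighbour (inj₂ ¬u) u~v | inj₁ (i , s , p , q) = contradiction (i , s , p) ¬u
    leaf-neighbour (inj₁ refl) u~v | inj₁ (i , s , p , q)
      with refl , refl ← end-injective M p = sym q

    leaf≢leg : ∀ {v i s} → i ≢ hub → Leaf v → v ≢ end M i s
    leaf≢leg i≢hub (inj₁ eq) v≡ = i≢hub (sym (proj₁ (end-injective M (trans eq v≡))))
    leaf≢leg i≢hub (inj₂ ¬v) v≡ = ¬v (_ , _ , sym v≡)

    module _ (bound : ∀ D → IsDominating G D → suc ℓ ≤ countF D)
             {t} {W : Fin t → V} (W-injective : ∀ {i j} → W i ≡ W j → i ≡ j)
             (W-leaf : ∀ i → Leaf (W i)) (W-complete : ∀ {v} → Leaf v → ∃ λ i → W i ≡ v) where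

      private
        leg : Fin ℓ → Bool → V
        leg i = end M (punchIn hub i)

        leg-injective : ∀ {i j a b} → leg i a ≡ leg j b → i ≡ j × a ≡ b
        leg-injective {i} {j} eq =
          let p , q = end-injective M eq in punchIn-injective hub i j p , q

        leg≢centre : ∀ {i a} → leg i a ≢ c
        leg≢centre {i} eq = punchInᵢ≢i hub i (proj₁ (end-injective M eq))

        leg≢leaf : ∀ {i a j} → leg i a ≢ W j
        leg≢leaf {i} {j = j} eq = leaf≢leg (punchInᵢ≢i hub i) (W-leaf j) (sym eq)

        -- An edge between leg vertices misses the centre, so the star property makes it a matching
        -- edge.
        leg-~ : ∀ {i j a b} → leg i a ~ leg j b → i ≡ j × not a ≡ b
        leg-~ e with star e
        ... | inj₂ (inj₁ eq) = contradiction eq leg≢centre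
        ... | inj₂ (inj₂ eq) = contradiction eq leg≢centre
        ... | inj₁ (k , r , p , q) with refl , refl ← end-injective M p = leg-injective q

      place : Spider ℓ t → V
      place centre    = c
      place (inner i) = leg i false
      place (outer i) = leg i true
      place (leaf i)  = W i

      place-injective : ∀ x y → place x ≡ place y → x ≡ y
      place-injective centre    centre    eq = refl
      place-injective centre    (inner j) eq = contradiction (sym eq) leg≢centre
      place-injective centre    (outer j) eq = contradiction (sym eq) leg≢centre
      place-injective centre    (leaf j)  eq = contradiction (sym eq) (leaf≢centre (W-leaf j))
      place-injective (inner i) centre    eq = contradiction eq leg≢centre
      place-injective (inner i) (inner j) eq = cong inner (proj₁ (leg-injective eq))
      place-injective (inner i) (outer j) eq with () ← proj₂ (leg-injective eq)
      place-injective (inner i) (leaf j)  eq = contradiction eq leg≢leaf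
      place-injective (outer i) centre    eq = contradiction eq leg≢centre
      place-injective (outer i) (inner j) eq with () ← proj₂ (leg-injective eq)
      place-injective (outer i) (outer j) eq = cong outer (proj₁ (leg-injective eq))
      place-injective (outer i) (leaf j)  eq = contradiction eq leg≢leaf
      place-injective (leaf i)  centre    eq = contradiction eq (leaf≢centre (W-leaf i))
      place-injective (leaf i)  (inner j) eq = contradiction (sym eq) leg≢leaf
      place-injective (leaf i)  (outer j) eq = contradiction (sym eq) leg≢leaf
      place-injective (leaf i)  (leaf j)  eq = cong leaf (W-injective eq)

      place-surjective : ∀ v → ∃ λ x → place x ≡ v
      place-surjective v with covered? M v
      ... | no ¬v = let i , eq = W-complete (inj₂ ¬v) in leaf i , eq
      ... | yes (l , s , refl) with hub ≟ l
      place-surjective v | yes (l , false , refl) | yes refl = centre , refl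
      place-surjective v | yes (l , true  , refl) | yes refl =
        let i , eq = W-complete (inj₁ refl) in leaf i , eq
      place-surjective v | yes (l , false , refl) | no hub≢l =
        inner (punchOut hub≢l) , cong (λ k → end M k false) (punchIn-punchOut hub≢l)
      place-surjective v | yes (l , true  , refl) | no hub≢l =
        outer (punchOut hub≢l) , cong (λ k → end M k true) (punchIn-punchOut hub≢l)

      place-adj : ∀ x y → adj G (place x) (place y) ≡ adjS x y
      place-adj centre    centre    = adj-irr G c
      place-adj centre    (inner j) = ~-sym (near _ (punchInᵢ≢i hub j))
      place-adj centre    (outer j) = ¬-not (far bound _ (punchInᵢ≢i hub j) ∘ ~-sym)
      place-adj centre    (leaf j)  = leaf-~-centre (W-leaf j)
      place-adj (inner i) centre    = near _ (punchInᵢ≢i hub i)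
      place-adj (inner i) (inner j) = ¬-not λ e → case proj₂ (leg-~ e) of λ ()
      place-adj (inner i) (outer j) with i ≟ j
      ... | yes refl = end-~ M (punchIn hub i)
      ... | no i≢j   = ¬-not (i≢j ∘ proj₁ ∘ leg-~)
      place-adj (inner i) (leaf j)  = ¬-not (leg≢centre ∘ leaf-neighbour (W-leaf j) ∘ ~-sym)
      place-adj (outer i) centre    = ¬-not (far bound _ (punchInᵢ≢i hub i))
      place-adj (outer i) (inner j) with i ≟ j
      ... | yes refl = ~-sym (end-~ M (punchIn hub i))
      ... | no i≢j   = ¬-not (i≢j ∘ proj₁ ∘ leg-~)
      place-adj (outer i) (outer j) = ¬-not λ e → case proj₂ (leg-~ e) of λ ()
      place-adj (outer i) (leaf j)  = ¬-not (leg≢centre ∘ leaf-neighbour (W-leaf j) ∘ ~-sym)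
      place-adj (leaf i)  centre    = ~-sym (leaf-~-centre (W-leaf i))
      place-adj (leaf i)  (inner j) = ¬-not (leg≢centre ∘ leaf-neighbour (W-leaf i))
      place-adj (leaf i)  (outer j) = ¬-not (leg≢centre ∘ leaf-neighbour (W-leaf i))
      place-adj (leaf i)  (leaf j)  =
        ¬-not (leaf≢centre (W-leaf j) ∘ leaf-neighbour (W-leaf i))

  -- From the spider to the isomorphism with the tree.

  Spider⇒IsoT : ∀ {s t} (place : Spider (2 + s) t → V) →
    (∀ x y → place x ≡ place y → x ≡ y) → (∀ v → ∃ λ x → place x ≡ v) →
    (∀ x y → adj G (place x) (place y) ≡ adjS x y) → IsoT G s t
  Spider⇒IsoT {s} {t} place inj surj place-adj =
    mk↔ₛ′ (fromSpider ∘ locate) (place ∘ toSpider)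
      (λ x → trans (cong fromSpider (locate-place (toSpider x))) (from-toSpider x))
      (λ v → trans (cong place (to-fromSpider (locate v))) (proj₂ (surj v))) ,
    adj-preserved
    where
    open ≡-Reasoning
    locate : V → Spider (2 + s) t
    locate v = proj₁ (surj v)
    locate-place : ∀ x → locate (place x) ≡ x
    locate-place x = inj _ _ (proj₂ (surj (place x)))
    adj-preserved : ∀ u v →
      adj G u v ≡ Tadj s t (fromSpider (locate u)) (fromSpider (locate v))
    adj-preserved u v = begin
      adj G u v
        ≡⟨ cong₂ (adj G) (proj₂ (surj u)) (proj₂ (surj v)) ⟨
      adj G (place (locate u)) (place (locate v))
        ≡⟨ place-adj (locate u) (locate v) ⟩
      adjS (locate u) (locate v)
        ≡⟨ cong₂ adjS (to-fromSpider (locate u)) (to-fromSpider (locate v)) ⟨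
      adjS (toSpider (fromSpider (locate u))) (toSpider (fromSpider (locate v)))
        ≡⟨ adjS-toSpider (fromSpider (locate u)) (fromSpider (locate v)) ⟩
      Tadj s t (fromSpider (locate u)) (fromSpider (locate v)) ∎

  -- A single vertex does not dominate, so there is a second vertex, and a walk to it leaves `v`.
  every-vertex-has-neighbour : Connected G → ∀ {k} → 2 ≤ k →
    (∀ D → IsDominating G D → k ≤ countF D) → ∀ v → ∃ λ w → v ~ w
  every-vertex-has-neighbour conn 2≤k bound v with undominated bound {1} 2≤k (λ _ → v)
  ... | w , undom = has-neighbour conn (proj₁ (undom zero) ∘ sym)

  -- The hub edge is not a leg of length two: its ends become the centre and a leaf. So `3 + s`
  -- matching edges yield `2 + s` legs.
  centred-matching⇒IsoT : ∀ {s} → CentredMatching (3 + s) → (∀ v → ∃ λ w → v ~ w) →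
    (∀ D → IsDominating G D → 3 + s ≤ countF D) → ∃ λ t → 1 ≤ t × IsoT G s t
  centred-matching⇒IsoT C neighbour bound with enumerate (leaf? C neighbour)
  ... | t , W , W-injective , W-leaf , W-complete =
    t , nonempty (proj₁ (W-complete (inj₁ refl))) ,
    Spider⇒IsoT (place C neighbour bound W-injective W-leaf W-complete)
      (place-injective C neighbour bound W-injective W-leaf W-complete)
      (place-surjective C neighbour bound W-injective W-leaf W-complete)
      (place-adj C neighbour bound W-injective W-leaf W-complete)
    where
    nonempty : ∀ {t} → Fin t → 1 ≤ t
    nonempty zero    = s≤s z≤n
    nonempty (suc _) = s≤s z≤n

theorem3p6 : (G : Graph) (k : ℕ) → Connected G → IsNu2 G k → k < edgeCount G → 5 ≤ k →
    IsGamma G (k ∸ 1) →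
    Σ ℕ λ s → Σ ℕ λ t → 1 ≤ s × 1 ≤ t × s + 4 ≡ k × IsoT G s t
theorem3p6 G (suc (suc (suc (suc (suc r))))) conn (_ , packing) _
    5≤k@(s≤s (s≤s (s≤s (s≤s (s≤s _))))) (_ , domination) =
  let neighbour   = every-vertex-has-neighbour G conn (s≤s (s≤s z≤n)) domination
      C           = centred-matching G conn packing (s≤s⁻¹ 5≤k)
                      (matching-of-size G neighbour domination ≤-refl)
      t , 1≤t , iso = centred-matching⇒IsoT G C neighbour domination
  -- For `k = 5 + r` the matching has `4 + r` edges, which is `3 + s` for `s = suc r`.
  in suc r , t , s≤s z≤n , 1≤t , +-comm (suc r) 4 , iso
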